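{- Let $F:\mathcal{C}\to\mathcal{C}$ be an endofunctor and let $\alpha:X\to FX$, $\beta:Y\to FY$ be $F$-coalgebras. If $\mathcal{C}$ is a regular category, then every AM-bisimulation from $\alpha$ to $\beta$ is a regular AM-bisimulation from $\alpha$ to $\beta$. If additionally $\mathcal{C}$ satisfies the regular axiom of choice, then every regular AM-bisimulation from $\alpha$ to $\beta$ is an AM-bisimulation from $\alpha$ to $\beta$.
   Context: A relation from $X$ to $Y$ is a subobject of $X\times Y$, i.e. an equivalence class of monos $m:R\rightarrowtail X\times Y$ (two monos being equivalent if each factors through the other). $\pi_1,\pi_2$ denote the projections of a binary product. An $F$-coalgebra is a morphism $\alpha:X\to FX$. AM-bisimulation (Aczel-Mendler bisimulation): a relation from $X$ to $Y$ is an AM-bisimulation from $\alpha$ to $\beta$ if for any mono $r:R\rightarrowtail X\times Y$ representing it there is a morphism $W:R\to FR$ such that $(\alpha\times\beta)\cdot r=\langle F\pi_1,F\pi_2\rangle\cdot Fr\cdot W:R\to FX\times FY$. Regular AM-bisimulation: a relation from $X$ to $Y$ is a regular AM-bisimulation from $\alpha$ to $\beta$ if for any mono $r:R\rightarrowtail X\times Y$ representing it there is a mono $w:W\rightarrowtail FR\times R$ such that $\pi_2\cdot w:W\to R$ is a regular epi and $$(\alpha\times\beta)\cdot r\cdot\pi_2\cdot w=\langle F\pi_1,F\pi_2\rangle\cdot Fr\cdot\pi_1\cdot w : W\to FX\times FY .$$ A category satisfies the regular axiom of choice if every regular epi is split. -}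

module Defs where

open import Level using (Level; _⊔_; suc)
open import Data.Product using (Σ-syntax; ∃-syntax; _×_; _,_)
open import Relation.Binary.Core using (Rel)
open import Relation.Binary.Bundles using (Setoid)
open import Relation.Binary.Structures using (IsEquivalence)

-- Hom-sets are setoids: equations between morphisms are stated with _≈_, and
-- uniqueness is always uniqueness up to _≈_.

record Category (o ℓ e : Level) : Set (suc (o ⊔ ℓ ⊔ e)) where
  infix  4 _≈_ _⇒_
  infixr 9 _∘_
  field
    Obj : Set o
    _⇒_ : Obj → Obj → Set ℓ
    _≈_ : ∀ {A B} → Rel (A ⇒ B) e
    id  : ∀ {A} → A ⇒ A
    _∘_ : ∀ {A B C} → B ⇒ C → A ⇒ B → A ⇒ C

    assoc     : ∀ {A B C D} {f : A ⇒ B} {g : B ⇒ C} {h : C ⇒ D} →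
                (h ∘ g) ∘ f ≈ h ∘ (g ∘ f)
    identityˡ : ∀ {A B} {f : A ⇒ B} → id ∘ f ≈ f
    identityʳ : ∀ {A B} {f : A ⇒ B} → f ∘ id ≈ f
    equiv     : ∀ {A B} → IsEquivalence (_≈_ {A} {B})
    ∘-resp-≈  : ∀ {A B C} {f h : B ⇒ C} {g i : A ⇒ B} →
                f ≈ h → g ≈ i → f ∘ g ≈ h ∘ i

  hom-setoid : (A B : Obj) → Setoid ℓ e
  hom-setoid A B = record { Carrier = A ⇒ B ; _≈_ = _≈_ ; isEquivalence = equiv }

  module Equiv {A B : Obj} = IsEquivalence (equiv {A} {B})

record Endofunctor {o ℓ e : Level} (C : Category o ℓ e) : Set (o ⊔ ℓ ⊔ e) where
  open Category C
  field
    F₀ : Obj → Obj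
    F₁ : ∀ {A B} → A ⇒ B → F₀ A ⇒ F₀ B

    F-identity     : ∀ {A} → F₁ (id {A}) ≈ id
    F-homomorphism : ∀ {A B C} {f : A ⇒ B} {g : B ⇒ C} → F₁ (g ∘ f) ≈ F₁ g ∘ F₁ f
    F-resp-≈       : ∀ {A B} {f g : A ⇒ B} → f ≈ g → F₁ f ≈ F₁ g

Coalgebra : {o ℓ e : Level} {C : Category o ℓ e} →
            Endofunctor C → Category.Obj C → Set ℓ
Coalgebra {C = C} F X = X ⇒ F₀ X
  where open Category C
        open Endofunctor F

module _ {o ℓ e : Level} (C : Category o ℓ e) where
  open Category C

  Mono : ∀ {A B} → A ⇒ B → Set (o ⊔ ℓ ⊔ e)
  Mono {A} f = ∀ {Z} (g h : Z ⇒ A) → f ∘ g ≈ f ∘ h → g ≈ h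

  SplitEpi : ∀ {A B} → A ⇒ B → Set (ℓ ⊔ e)
  SplitEpi {A} {B} f = Σ[ s ∈ B ⇒ A ] f ∘ s ≈ id

  record IsCoequalizer {A B Q} (f g : A ⇒ B) (q : B ⇒ Q) : Set (o ⊔ ℓ ⊔ e) where
    field
      equality   : q ∘ f ≈ q ∘ g
      coequalize : ∀ {Z} (h : B ⇒ Z) → h ∘ f ≈ h ∘ g → Q ⇒ Z
      universal  : ∀ {Z} {h : B ⇒ Z} (eq : h ∘ f ≈ h ∘ g) → coequalize h eq ∘ q ≈ h
      unique     : ∀ {Z} {h : B ⇒ Z} (eq : h ∘ f ≈ h ∘ g) {i : Q ⇒ Z} →
                   i ∘ q ≈ h → i ≈ coequalize h eq

  RegularEpi : ∀ {A B} → A ⇒ B → Set (o ⊔ ℓ ⊔ e)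
  RegularEpi {A} q = ∃[ K ] Σ[ f ∈ K ⇒ A ] Σ[ g ∈ K ⇒ A ] IsCoequalizer f g q

  RegularAxiomOfChoice : Set (o ⊔ ℓ ⊔ e)
  RegularAxiomOfChoice = ∀ {A B} (f : A ⇒ B) → RegularEpi f → SplitEpi f

  record Terminal : Set (o ⊔ ℓ ⊔ e) where
    field
      ⊤        : Obj
      !        : ∀ {A} → A ⇒ ⊤
      !-unique : ∀ {A} (f : A ⇒ ⊤) → f ≈ !

  record BinaryProducts : Set (o ⊔ ℓ ⊔ e) where
    infixr 7 _⊗_
    field
      _⊗_   : Obj → Obj → Obj
      π₁    : ∀ {A B} → A ⊗ B ⇒ A
      π₂    : ∀ {A B} → A ⊗ B ⇒ B
      ⟨_,_⟩ : ∀ {A B Z} → Z ⇒ A → Z ⇒ B → Z ⇒ A ⊗ B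

      project₁ : ∀ {A B Z} {f : Z ⇒ A} {g : Z ⇒ B} → π₁ ∘ ⟨ f , g ⟩ ≈ f
      project₂ : ∀ {A B Z} {f : Z ⇒ A} {g : Z ⇒ B} → π₂ ∘ ⟨ f , g ⟩ ≈ g
      unique   : ∀ {A B Z} {f : Z ⇒ A} {g : Z ⇒ B} {h : Z ⇒ A ⊗ B} →
                 π₁ ∘ h ≈ f → π₂ ∘ h ≈ g → h ≈ ⟨ f , g ⟩

    infixr 7 _⊗₁_
    _⊗₁_ : ∀ {A A′ B B′} → A ⇒ A′ → B ⇒ B′ → A ⊗ B ⇒ A′ ⊗ B′
    f ⊗₁ g = ⟨ f ∘ π₁ , g ∘ π₂ ⟩

  record Equalizers : Set (o ⊔ ℓ ⊔ e) where
    field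
      Eq  : ∀ {A B} (f g : A ⇒ B) → Obj
      arr : ∀ {A B} (f g : A ⇒ B) → Eq f g ⇒ A

      equality  : ∀ {A B} (f g : A ⇒ B) → f ∘ arr f g ≈ g ∘ arr f g
      equalize  : ∀ {A B Z} {f g : A ⇒ B} (h : Z ⇒ A) → f ∘ h ≈ g ∘ h → Z ⇒ Eq f g
      universal : ∀ {A B Z} {f g : A ⇒ B} {h : Z ⇒ A} (eq : f ∘ h ≈ g ∘ h) →
                  arr f g ∘ equalize h eq ≈ h
      unique    : ∀ {A B Z} {f g : A ⇒ B} {h : Z ⇒ A} (eq : f ∘ h ≈ g ∘ h)
                  {i : Z ⇒ Eq f g} → arr f g ∘ i ≈ h → i ≈ equalize h eq

  record IsPullback {P A B Z} (p₁ : P ⇒ A) (p₂ : P ⇒ B) (f : A ⇒ Z) (g : B ⇒ Z) :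
                    Set (o ⊔ ℓ ⊔ e) where
    field
      commute    : f ∘ p₁ ≈ g ∘ p₂
      pair       : ∀ {D} (h : D ⇒ A) (k : D ⇒ B) → f ∘ h ≈ g ∘ k → D ⇒ P
      p₁∘pair≈h  : ∀ {D} {h : D ⇒ A} {k : D ⇒ B} (eq : f ∘ h ≈ g ∘ k) →
                   p₁ ∘ pair h k eq ≈ h
      p₂∘pair≈k  : ∀ {D} {h : D ⇒ A} {k : D ⇒ B} (eq : f ∘ h ≈ g ∘ k) →
                   p₂ ∘ pair h k eq ≈ k
      unique     : ∀ {D} {h : D ⇒ A} {k : D ⇒ B} (eq : f ∘ h ≈ g ∘ k) {i : D ⇒ P} →
                   p₁ ∘ i ≈ h → p₂ ∘ i ≈ k → i ≈ pair h k eq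

  -- Finite completeness is given by a terminal object, binary products and
  -- equalizers.
  record Regular : Set (o ⊔ ℓ ⊔ e) where
    field
      terminal       : Terminal
      binaryProducts : BinaryProducts
      equalizers     : Equalizers

      kernelPair-coequalizer :
        ∀ {K A B} (f : A ⇒ B) (p₁ p₂ : K ⇒ A) → IsPullback p₁ p₂ f f →
        ∃[ Q ] Σ[ q ∈ A ⇒ Q ] IsCoequalizer p₁ p₂ q

      regularEpi-stable :
        ∀ {P A B Z} {p₁ : P ⇒ A} {p₂ : P ⇒ B} {f : A ⇒ Z} {g : B ⇒ Z} →
        IsPullback p₁ p₂ f g → RegularEpi f → RegularEpi p₂

  -- A subobject is given by a mono representing it. Equality of subobjects is
  -- _≈ₛ_, so r ≈ₛ R says that the mono r represents the subobject R.
  record Subobject (A : Obj) : Set (o ⊔ ℓ ⊔ e) where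
    field
      {dom} : Obj
      arr   : dom ⇒ A
      mono  : Mono arr

  module _ {A : Obj} where
    open Subobject

    infix 4 _≤ₛ_ _≈ₛ_

    _≤ₛ_ : Rel (Subobject A) (ℓ ⊔ e)
    m ≤ₛ n = Σ[ k ∈ dom m ⇒ dom n ] arr n ∘ k ≈ arr m

    _≈ₛ_ : Rel (Subobject A) (ℓ ⊔ e)
    m ≈ₛ n = m ≤ₛ n × n ≤ₛ m

    ≤ₛ-refl : ∀ {m} → m ≤ₛ m
    ≤ₛ-refl = id , identityʳ

    ≤ₛ-trans : ∀ {m n p} → m ≤ₛ n → n ≤ₛ p → m ≤ₛ p
    ≤ₛ-trans (j , arr∘j≈) (k , arr∘k≈) =
      k ∘ j ,
      Equiv.trans (Equiv.sym assoc) (Equiv.trans (∘-resp-≈ arr∘k≈ Equiv.refl) arr∘j≈)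

    ≈ₛ-isEquivalence : IsEquivalence _≈ₛ_
    ≈ₛ-isEquivalence = record
      { refl  = λ {m} → ≤ₛ-refl {m} , ≤ₛ-refl {m}
      ; sym   = λ (p , q) → q , p
      ; trans = λ {m} {n} {p} (m≤n , n≤m) (n≤p , p≤n) →
                  ≤ₛ-trans {m} {n} {p} m≤n n≤p , ≤ₛ-trans {p} {n} {m} p≤n n≤m
      }

module _ {o ℓ e : Level} {C : Category o ℓ e} (products : BinaryProducts C) where
  open Category C
  open BinaryProducts products
  open Subobject

  Relation : Obj → Obj → Set (o ⊔ ℓ ⊔ e)
  Relation X Y = Subobject C (X ⊗ Y)

  module _ (F : Endofunctor C) {X Y : Obj} (α : Coalgebra F X) (β : Coalgebra F Y) where
    open Endofunctor F

    IsAMBisimulation : Relation X Y → Set (o ⊔ ℓ ⊔ e)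
    IsAMBisimulation R =
      ∀ (r : Subobject C (X ⊗ Y)) → _≈ₛ_ C r R →
      Σ[ W ∈ dom r ⇒ F₀ (dom r) ]
        (α ⊗₁ β) ∘ arr r ≈ ⟨ F₁ π₁ , F₁ π₂ ⟩ ∘ F₁ (arr r) ∘ W

    IsRegularAMBisimulation : Relation X Y → Set (o ⊔ ℓ ⊔ e)
    IsRegularAMBisimulation R =
      ∀ (r : Subobject C (X ⊗ Y)) → _≈ₛ_ C r R →
      ∃[ W ] Σ[ w ∈ W ⇒ F₀ (dom r) ⊗ dom r ]
        Mono C w
        × RegularEpi C (π₂ ∘ w)
        × (α ⊗₁ β) ∘ arr r ∘ π₂ ∘ w ≈ ⟨ F₁ π₁ , F₁ π₂ ⟩ ∘ F₁ (arr r) ∘ π₁ ∘ w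

{-# OPTIONS --safe #-}
module Submission where

open import Defs
open import Level using (Level)
open import Data.Product using (_×_; _,_)
import Relation.Binary.Reasoning.Setoid as SetoidReasoning

-- An AM-bisimulation W : R → FR is turned into its graph ⟨ W , id ⟩, whose second
-- projection is the identity. Conversely, a section s of π₂ ∘ w yields the
-- coalgebra structure π₁ ∘ w ∘ s on R.

-- A regular AM-bisimulation equips `R` with a relation `w` from `F R` to `R`, total in the sense
-- that `π₂ ∘ w` is a regular epi; a plain one equips it with a morphism `R ⇒ F R`. A morphism is
-- such a relation through its graph, and under choice a total relation contains the graph of a
-- morphism. Both directions keep the representing mono `r` fixed, so `R` enters only through its
-- representatives.

module _ {o ℓ e : Level} (C : Category o ℓ e) where
  open Category C

  ∘-resp-≈ʳ : ∀ {A B D} {f : B ⇒ D} {g h : A ⇒ B} → g ≈ h → f ∘ g ≈ f ∘ h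
  ∘-resp-≈ʳ = ∘-resp-≈ Equiv.refl

  ∘-resp-≈ˡ : ∀ {A B D} {f g : B ⇒ D} {h : A ⇒ B} → f ≈ g → f ∘ h ≈ g ∘ h
  ∘-resp-≈ˡ f≈g = ∘-resp-≈ f≈g Equiv.refl

  assoc₃ : ∀ {V A B D E} {f : D ⇒ E} {g : B ⇒ D} {h : A ⇒ B} {k : V ⇒ A} →
           (f ∘ g ∘ h) ∘ k ≈ f ∘ g ∘ h ∘ k
  assoc₃ = Equiv.trans assoc (∘-resp-≈ʳ assoc)

  elimʳ : ∀ {A B} {f : A ⇒ B} {g : A ⇒ A} → g ≈ id → f ∘ g ≈ f
  elimʳ g≈id = Equiv.trans (∘-resp-≈ʳ g≈id) identityʳ

  -- Needed for graphs: `⟨ W , id ⟩` has the retraction `π₂`.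
  retraction⇒mono : ∀ {A B} {f : A ⇒ B} (s : B ⇒ A) → s ∘ f ≈ id → Mono C f
  retraction⇒mono {A} {f = f} s s∘f≈id {Z} g h f∘g≈f∘h = begin
    g            ≈⟨ identityˡ ⟨
    id ∘ g       ≈⟨ ∘-resp-≈ˡ s∘f≈id ⟨
    (s ∘ f) ∘ g  ≈⟨ assoc ⟩
    s ∘ f ∘ g    ≈⟨ ∘-resp-≈ʳ f∘g≈f∘h ⟩
    s ∘ f ∘ h    ≈⟨ assoc ⟨
    (s ∘ f) ∘ h  ≈⟨ ∘-resp-≈ˡ s∘f≈id ⟩
    id ∘ h       ≈⟨ identityˡ ⟩
    h            ∎
    where open SetoidReasoning (hom-setoid Z A)

  -- Such an `f` coequalizes the trivial pair `id , id`, every `h` factoring through it as `h`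
  -- itself.
  ≈id⇒regularEpi : ∀ {A} {f : A ⇒ A} → f ≈ id → RegularEpi C f
  ≈id⇒regularEpi {A} f≈id = A , id , id , record
    { equality   = Equiv.refl
    ; coequalize = λ h _ → h
    ; universal  = λ _ → elimʳ f≈id
    ; unique     = λ _ i∘f≈h → Equiv.trans (Equiv.sym (elimʳ f≈id)) i∘f≈h
    }

module _ {o ℓ e : Level} {C : Category o ℓ e} (products : BinaryProducts C)
         (F : Endofunctor C) {X Y : Category.Obj C}
         (α : Coalgebra F X) (β : Coalgebra F Y) where
  open Category C
  open BinaryProducts products
  open Endofunctor F
  open Subobject

  AM⇒regularAM : (R : Relation products X Y) →
                 IsAMBisimulation products F α β R →
                 IsRegularAMBisimulation products F α β R
  AM⇒regularAM R am r r≈R with am r r≈R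
  ... | W , eq =
    -- The one equation `π₂ ∘ ⟨ W , id ⟩ ≈ id` gives both the mono and the regular epi.
    dom r , ⟨ W , id ⟩ , retraction⇒mono C π₂ project₂ , ≈id⇒regularEpi C project₂ ,
    (begin
      (α ⊗₁ β) ∘ arr r ∘ π₂ ∘ ⟨ W , id ⟩
        ≈⟨ ∘-resp-≈ʳ C (elimʳ C project₂) ⟩
      (α ⊗₁ β) ∘ arr r
        ≈⟨ eq ⟩
      ⟨ F₁ π₁ , F₁ π₂ ⟩ ∘ F₁ (arr r) ∘ W
        ≈⟨ ∘-resp-≈ʳ C (∘-resp-≈ʳ C project₁) ⟨
      ⟨ F₁ π₁ , F₁ π₂ ⟩ ∘ F₁ (arr r) ∘ π₁ ∘ ⟨ W , id ⟩ ∎)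
    where open SetoidReasoning (hom-setoid (dom r) (F₀ X ⊗ F₀ Y))

  regularAM⇒AM : RegularAxiomOfChoice C → (R : Relation products X Y) →
                 IsRegularAMBisimulation products F α β R →
                 IsAMBisimulation products F α β R
  regularAM⇒AM choice R regularAM r r≈R with regularAM r r≈R
  ... | _ , w , _ , π₂∘w-regularEpi , eq with choice (π₂ ∘ w) π₂∘w-regularEpi
  ...   | s , π₂∘w∘s≈id =
    (π₁ ∘ w) ∘ s ,
    (begin
      (α ⊗₁ β) ∘ arr r
        -- Inserting the identity `(π₂ ∘ w) ∘ s` exposes the left side of `eq` precomposed with `s`.
        ≈⟨ ∘-resp-≈ʳ C (elimʳ C π₂∘w∘s≈id) ⟨
      (α ⊗₁ β) ∘ arr r ∘ (π₂ ∘ w) ∘ s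
        ≈⟨ assoc₃ C ⟨
      ((α ⊗₁ β) ∘ arr r ∘ π₂ ∘ w) ∘ s
        ≈⟨ ∘-resp-≈ˡ C eq ⟩
      (⟨ F₁ π₁ , F₁ π₂ ⟩ ∘ F₁ (arr r) ∘ π₁ ∘ w) ∘ s
        ≈⟨ assoc₃ C ⟩
      ⟨ F₁ π₁ , F₁ π₂ ⟩ ∘ F₁ (arr r) ∘ (π₁ ∘ w) ∘ s ∎)
    where open SetoidReasoning (hom-setoid (dom r) (F₀ X ⊗ F₀ Y))

proposition2p13 : {o ℓ e : Level} (C : Category o ℓ e) (regular : Regular C) (F : Endofunctor C)
    {X Y : Category.Obj C} (α : Coalgebra F X) (β : Coalgebra F Y) →
    let products = Regular.binaryProducts regular in
    ((R : Relation products X Y) →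
    IsAMBisimulation products F α β R → IsRegularAMBisimulation products F α β R)
    × (RegularAxiomOfChoice C → (R : Relation products X Y) →
    IsRegularAMBisimulation products F α β R → IsAMBisimulation products F α β R)
proposition2p13 C regular F α β =
  AM⇒regularAM products F α β , regularAM⇒AM products F α β
  where products = Regular.binaryProducts regular
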